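{- Let $M$ be a matroid on a finite ground set $E$ with rank function $r_M$, let $q$ be a non-zero (complex) number, and let $\bm v=(v_e)_{e\in E}$ and $\bm u=(u_e)_{e\in E}$ be arbitrary sequences of (complex) numbers indexed by $E$. Then $$\widetilde Z(M;q,\bm v)=\sum_{F\subseteq E}q^{ -r_M(F)}\Big(\prod_{e\in F}(v_e-u_e)\Big)\,\widetilde Z\big(M/F;q,(u_e)_{e\in E-F}\big).$$
   Context: A matroid $M$ on a finite ground set $E$ is determined by its rank function $r_M:2^E\to\mathbb Z_{\ge 0}$. For a non-zero number $q$ and a sequence $\bm v=(v_e)_{e\in E}$ of numbers, the normalized Potts model partition function of $M$ is $$\widetilde Z(M;q,\bm v)=\sum_{A\subseteq E}q^{ -r_M(A)}\prod_{e\in A}v_e.$$ For $F\subseteq E$, the contraction $M/F$ is the matroid on $E-F$ with rank function $r_{M/F}(A)=r_M(A\cup F)-r_M(F)$ for all $A\subseteq E-F$. Empty products equal $1$. -}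

module Defs where

open import Algebra.Apartness.Bundles using (HeytingCommutativeRing; HeytingField)
import Algebra.Apartness.Properties.HeytingCommutativeRing as HeytingProperties
open import Algebra.Bundles using (CommutativeRing)
import Algebra.Properties.Semiring.Exp as Exp
open import Data.Fin.Base using (Fin; zero; suc)
open import Data.Fin.Subset
  using (Subset; inside; outside; _⊆_; _∪_; _∩_; _─_; ∣_∣)
open import Data.Fin.Subset.Properties
open import Data.List.Base as List using (List; []; _∷_; _++_; foldr)
open import Data.List.Membership.Propositional using (_∈_)
open import Data.List.Membership.Propositional.Properties
  using (∈-map⁺; ∈-map⁻; ∈-++⁺ˡ; ∈-++⁺ʳ)
open import Data.List.Properties using (map-++; map-∘)
open import Data.List.Relation.Binary.Disjoint.Propositional using (Disjoint)
open import Data.List.Relation.Unary.Any using (here)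
open import Data.List.Relation.Unary.All using ([])
open import Data.List.Relation.Unary.AllPairs using ([]; _∷_)
open import Data.List.Relation.Unary.Unique.Propositional using (Unique)
open import Data.List.Relation.Unary.Unique.Propositional.Properties
  using () renaming (map⁺ to unique-map⁺; ++⁺ to unique-++⁺)
open import Data.Nat.Base using (ℕ; _+_; _∸_; _≤_)
open import Data.Nat.Properties
  using (∸-monoˡ-≤; m≤n+o⇒m∸n≤o; m∸n+n≡m; +-cancelʳ-≤; +-comm; +-monoʳ-≤;
         m≤m+n; module ≤-Reasoning)
open import Data.Nat.Solver using (module +-*-Solver)
open import Data.Product.Base using (∃; _,_; proj₁; proj₂)
open import Data.Sum.Base using (inj₁; inj₂)
open import Data.Vec.Base as Vec using ([]; _∷_)
open import Data.Vec.Properties using (∷-injectiveʳ)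
open import Relation.Binary.PropositionalEquality
  using (_≡_; refl; sym; trans; cong; cong₂; subst)

private
  variable
    n : ℕ

∪-lub : ∀ (A B : Subset n) {C} → A ⊆ C → B ⊆ C → A ∪ B ⊆ C
∪-lub A B A⊆C B⊆C x∈A∪B with x∈p∪q⁻ A B x∈A∪B
... | inj₁ x∈A = A⊆C x∈A
... | inj₂ x∈B = B⊆C x∈B

∪-monoˡ : ∀ {A B : Subset n} (C : Subset n) → A ⊆ B → A ∪ C ⊆ B ∪ C
∪-monoˡ {A = A} {B} C A⊆B =
  ∪-lub A C (λ x∈A → p⊆p∪q C (A⊆B x∈A)) (q⊆p∪q B C)

-- A matroid whose ground set is a subset of Fin n, so that contractions need
-- no relabelling.  Only the values of rank on subsets of the ground set are
-- meaningful; the others are unconstrained.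
record Matroid (n : ℕ) : Set where
  field
    ground          : Subset n
    rank            : Subset n → ℕ
    rank-bounded    : ∀ {A} → A ⊆ ground → rank A ≤ ∣ A ∣
    rank-monotone   : ∀ {A B} → A ⊆ B → B ⊆ ground → rank A ≤ rank B
    rank-submodular : ∀ {A B} → A ⊆ ground → B ⊆ ground →
                      rank (A ∪ B) + rank (A ∩ B) ≤ rank A + rank B

-- The truncated subtraction in the rank is exact on subsets of ground M ─ F,
-- because rank M is monotone.
contract : (M : Matroid n) (F : Subset n) → F ⊆ Matroid.ground M → Matroid n
contract {n} M F F⊆E = record
  { ground          = E ─ F
  ; rank            = λ A → rank (A ∪ F) ∸ rank F
  ; rank-bounded    = λ {A} A⊆ → bounded A (λ x∈A → p─q⊆p E F (A⊆ x∈A))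
  ; rank-monotone   = λ {A} {B} A⊆B B⊆ →
      ∸-monoˡ-≤ (rank F)
        (rank-monotone (∪-monoˡ F A⊆B) (∪F⊆E B (λ x∈B → p─q⊆p E F (B⊆ x∈B))))
  ; rank-submodular = λ {A} {B} A⊆ B⊆ →
      submodular A B (λ x∈A → p─q⊆p E F (A⊆ x∈A)) (λ x∈B → p─q⊆p E F (B⊆ x∈B))
  }
  where
  open Matroid M renaming (ground to E)

  ∪F⊆E : ∀ A → A ⊆ E → A ∪ F ⊆ E
  ∪F⊆E A A⊆E = ∪-lub A F A⊆E F⊆E

  bounded : ∀ A → A ⊆ E → rank (A ∪ F) ∸ rank F ≤ ∣ A ∣
  bounded A A⊆E = m≤n+o⇒m∸n≤o (rank (A ∪ F)) (rank F) (begin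
    rank (A ∪ F)                 ≤⟨ m≤m+n _ _ ⟩
    rank (A ∪ F) + rank (A ∩ F)  ≤⟨ rank-submodular A⊆E F⊆E ⟩
    rank A + rank F              ≡⟨ +-comm (rank A) (rank F) ⟩
    rank F + rank A              ≤⟨ +-monoʳ-≤ (rank F) (rank-bounded A⊆E) ⟩
    rank F + ∣ A ∣               ∎)
    where open ≤-Reasoning

  ∪F-∪ : ∀ A B → (A ∪ F) ∪ (B ∪ F) ≡ (A ∪ B) ∪ F
  ∪F-∪ A B = ⊆-antisym
    (∪-lub (A ∪ F) (B ∪ F) (∪-monoˡ F (p⊆p∪q {p = A} B)) (∪-monoˡ F (q⊆p∪q A B)))
    (∪-lub (A ∪ B) F
      (∪-lub A B (λ x∈A → p⊆p∪q (B ∪ F) (p⊆p∪q F x∈A))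
                 (λ x∈B → q⊆p∪q (A ∪ F) (B ∪ F) (p⊆p∪q F x∈B)))
      (λ x∈F → p⊆p∪q (B ∪ F) (q⊆p∪q A F x∈F)))

  submodular : ∀ A B → A ⊆ E → B ⊆ E →
    (rank ((A ∪ B) ∪ F) ∸ rank F) + (rank ((A ∩ B) ∪ F) ∸ rank F) ≤
    (rank (A ∪ F) ∸ rank F) + (rank (B ∪ F) ∸ rank F)
  submodular A B A⊆E B⊆E = +-cancelʳ-≤ (r + r) _ _ (begin
    ((rank ((A ∪ B) ∪ F) ∸ r) + (rank ((A ∩ B) ∪ F) ∸ r)) + (r + r)
      ≡⟨ restore (A ∪ B) (A ∩ B) (∪-lub A B A⊆E B⊆E) (λ x∈ → A⊆E (p∩q⊆p A B x∈)) ⟩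
    rank ((A ∪ B) ∪ F) + rank ((A ∩ B) ∪ F)
      ≡⟨ cong₂ _+_ (cong rank (sym (∪F-∪ A B))) (cong rank (∪-distribʳ-∩ F A B)) ⟩
    rank ((A ∪ F) ∪ (B ∪ F)) + rank ((A ∪ F) ∩ (B ∪ F))
      ≤⟨ rank-submodular (∪F⊆E A A⊆E) (∪F⊆E B B⊆E) ⟩
    rank (A ∪ F) + rank (B ∪ F)
      ≡⟨ sym (restore A B A⊆E B⊆E) ⟩
    ((rank (A ∪ F) ∸ r) + (rank (B ∪ F) ∸ r)) + (r + r) ∎)
    where
    open ≤-Reasoning
    r : ℕ
    r = rank F

    swap : ∀ a b c → (a + b) + (c + c) ≡ (a + c) + (b + c)
    swap = solve 3 (λ a b c → (a :+ b) :+ (c :+ c) := (a :+ c) :+ (b :+ c)) refl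
      where open +-*-Solver

    exact : ∀ C → C ⊆ E → (rank (C ∪ F) ∸ r) + r ≡ rank (C ∪ F)
    exact C C⊆E = m∸n+n≡m (rank-monotone (q⊆p∪q C F) (∪F⊆E C C⊆E))

    restore : ∀ C D → C ⊆ E → D ⊆ E →
      ((rank (C ∪ F) ∸ r) + (rank (D ∪ F) ∸ r)) + (r + r) ≡
      rank (C ∪ F) + rank (D ∪ F)
    restore C D C⊆E D⊆E =
      trans (swap (rank (C ∪ F) ∸ r) (rank (D ∪ F) ∸ r) r)
            (cong₂ _+_ (exact C C⊆E) (exact D D⊆E))

skip : ∀ {s} {E : Subset n} → (∃ λ A → A ⊆ E) → ∃ λ A → A ⊆ (s ∷ E)
skip (A , A⊆E) = (outside ∷ A) , λ {_} → out⊆ A⊆E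

take : ∀ {E : Subset n} → (∃ λ A → A ⊆ E) → ∃ λ A → A ⊆ (inside ∷ E)
take (A , A⊆E) = (inside ∷ A) , λ {_} → in⊆in A⊆E

subsets : (E : Subset n) → List (∃ λ A → A ⊆ E)
subsets []            = ([] , λ x∈ → x∈) ∷ []
subsets (outside ∷ E) = List.map skip (subsets E)
subsets (inside  ∷ E) = List.map skip (subsets E) ++ List.map take (subsets E)

-- subsets E lists every subset of E exactly once.
private
  sets : (E : Subset n) → List (Subset n)
  sets E = List.map proj₁ (subsets E)

  sets-out : (E : Subset n) → sets (outside ∷ E) ≡ List.map (outside ∷_) (sets E)
  sets-out E = trans (sym (map-∘ (subsets E))) (map-∘ (subsets E))

  sets-in : (E : Subset n) →
    sets (inside ∷ E) ≡ List.map (outside ∷_) (sets E) ++ List.map (inside ∷_) (sets E)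
  sets-in E = trans
    (map-++ proj₁ (List.map skip (subsets E)) (List.map take (subsets E)))
    (cong₂ _++_ (trans (sym (map-∘ (subsets E))) (map-∘ (subsets E)))
                 (trans (sym (map-∘ (subsets E))) (map-∘ (subsets E))))

subsets-complete : (A E : Subset n) → A ⊆ E → A ∈ List.map proj₁ (subsets E)
subsets-complete []            []            A⊆E = here refl
subsets-complete (outside ∷ A) (outside ∷ E) A⊆E =
  subst (_ ∈_) (sym (sets-out E))
    (∈-map⁺ (outside ∷_) (subsets-complete A E (drop-∷-⊆ A⊆E)))
subsets-complete (inside ∷ A)  (outside ∷ E) A⊆E with () ← A⊆E Vec.here
subsets-complete (outside ∷ A) (inside ∷ E)  A⊆E =
  subst (_ ∈_) (sym (sets-in E))
    (∈-++⁺ˡ (∈-map⁺ (outside ∷_) (subsets-complete A E (drop-∷-⊆ A⊆E))))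
subsets-complete (inside ∷ A)  (inside ∷ E)  A⊆E =
  subst (_ ∈_) (sym (sets-in E))
    (∈-++⁺ʳ (List.map (outside ∷_) (sets E))
      (∈-map⁺ (inside ∷_) (subsets-complete A E (drop-∷-⊆ A⊆E))))

subsets-unique : (E : Subset n) → Unique (List.map proj₁ (subsets E))
subsets-unique []            = [] ∷ []
subsets-unique (outside ∷ E) =
  subst Unique (sym (sets-out E)) (unique-map⁺ ∷-injectiveʳ (subsets-unique E))
subsets-unique (inside ∷ E)  =
  subst Unique (sym (sets-in E))
    (unique-++⁺ (unique-map⁺ ∷-injectiveʳ (subsets-unique E))
                (unique-map⁺ ∷-injectiveʳ (subsets-unique E))
                disjoint)
  where
  disjoint : Disjoint (List.map (outside ∷_) (sets E)) (List.map (inside ∷_) (sets E))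
  disjoint (A∈out , A∈in) with ∈-map⁻ (outside ∷_) A∈out | ∈-map⁻ (inside ∷_) A∈in
  ... | _ , _ , refl | _ , _ , ()

-- A Heyting field (field with tight apartness) stands in for the complex
-- numbers; "non-zero" is apartness from 0#.
module Potts {c ℓ₁ ℓ₂} (K : HeytingField c ℓ₁ ℓ₂) where

  open HeytingField K
    hiding (zero; refl) renaming (_+_ to _⊕_; sym to ≈-sym; trans to ≈-trans)
  open HeytingCommutativeRing heytingCommutativeRing using (commutativeRing)
  open CommutativeRing commutativeRing using (semiring)
  open Exp semiring public using (_^_)

  ∑⊆ : (E : Subset n) → (∀ A → A ⊆ E → Carrier) → Carrier
  ∑⊆ E f = foldr _⊕_ 0# (List.map (λ (A , A⊆E) → f A A⊆E) (subsets E))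

  ∏ : Subset n → (Fin n → Carrier) → Carrier
  ∏ []            f = 1#
  ∏ (inside  ∷ A) f = f zero * ∏ A (λ e → f (suc e))
  ∏ (outside ∷ A) f = ∏ A (λ e → f (suc e))

  -- Apartness from 0# yields an inverse of q - 0#, which also inverts q.
  inv : (q : Carrier) → q # 0# → Carrier
  inv q q#0 = proj₁ (#⇒invertible q#0)

  inv-inverseˡ : ∀ q (q#0 : q # 0#) → inv q q#0 * q ≈ 1#
  inv-inverseˡ q q#0 =
    ≈-trans (*-congˡ (≈-sym (x-0≈x q))) (proj₁ (proj₂ (#⇒invertible q#0)))
    where open HeytingProperties heytingCommutativeRing using (x-0≈x)

  -- Weights are given on all of Fin n, but only those on ground M are used;
  -- so for a contraction M/F the family is implicitly restricted to E ─ F.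
  Z̃ : (M : Matroid n) (q : Carrier) → q # 0# → (Fin n → Carrier) → Carrier
  Z̃ M q q#0 v = ∑⊆ ground λ A _ → inv q q#0 ^ rank A * ∏ A v
    where open Matroid M

{-# OPTIONS --safe #-}

-- Expanding ∏_{e∈S} v e = ∏_{e∈S} ((v e - u e) + u e) turns the sum over S
-- into one over all disjoint unions S = A ∪ F, with weight ∏_F (v - u) · ∏_A u.
-- Since A has rank r(A ∪ F) - r(F) in M/F, the powers of q⁻¹ agree term by term.
module Submission where

open import Defs
open import Algebra.Apartness.Bundles using (HeytingCommutativeRing; HeytingField)
open import Algebra.Bundles using (CommutativeRing)
import Algebra.Properties.CommutativeSemigroup as CommutativeSemigroupProperties
import Algebra.Properties.Group as GroupProperties
import Algebra.Properties.Semiring.Exp as ExpProperties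
open import Data.Fin.Base using (Fin; zero; suc)
open import Data.Fin.Subset using (Subset; inside; outside; _⊆_; _∪_; _─_)
open import Data.Fin.Subset.Properties using (p─q⊆p; q⊆p∪q)
open import Data.List.Base as List using (List; []; _∷_; _++_; foldr)
open import Data.List.Properties using (map-∘)
open import Data.Nat.Base as ℕ using (ℕ; _∸_)
open import Data.Nat.Properties using (m+[n∸m]≡n)
open import Data.Product.Base using (_,_)
open import Data.Vec.Base using ([]; _∷_)
open import Function.Base using (_∘_)
open import Level using (Level)
open import Relation.Binary.PropositionalEquality as ≡ using (_≡_)
import Relation.Binary.Reasoning.Setoid as SetoidReasoning

module _ {c ℓ₁ ℓ₂} (K : HeytingField c ℓ₁ ℓ₂) where

  open HeytingField K using (heytingCommutativeRing)
  open HeytingCommutativeRing heytingCommutativeRing using (commutativeRing)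
  open CommutativeRing commutativeRing hiding (zero)
  open Potts K using (∑⊆; ∏; _^_)
  open ExpProperties semiring using (^-homo-*; ^-congʳ)
  open CommutativeSemigroupProperties *-commutativeSemigroup using (interchange; x∙yz≈y∙xz)
  open CommutativeSemigroupProperties +-commutativeSemigroup using ()
    renaming (interchange to +-interchange)
  open SetoidReasoning setoid

  private
    variable
      a : Level
      X : Set a
      n : ℕ

  -- With `xs` taken to be `subsets E` this unfolds to `∑⊆ E`, so facts proved by induction on lists
  -- carry over to subset sums as they stand.
  ∑ : List X → (X → Carrier) → Carrier
  ∑ xs f = foldr _+_ 0# (List.map f xs)

  ∑-cong : ∀ (xs : List X) {f g} → (∀ x → f x ≈ g x) → ∑ xs f ≈ ∑ xs g
  ∑-cong []       f≈g = refl
  ∑-cong (x ∷ xs) f≈g = +-cong (f≈g x) (∑-cong xs f≈g)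

  ∑-distrib-+ : ∀ (xs : List X) f g → ∑ xs (λ x → f x + g x) ≈ ∑ xs f + ∑ xs g
  ∑-distrib-+ []       f g = sym (+-identityˡ 0#)
  ∑-distrib-+ (x ∷ xs) f g =
    trans (+-congˡ (∑-distrib-+ xs f g)) (+-interchange (f x) (g x) _ _)

  *-distribˡ-∑ : ∀ (xs : List X) k f → k * ∑ xs f ≈ ∑ xs (λ x → k * f x)
  *-distribˡ-∑ []       k f = zeroʳ k
  *-distribˡ-∑ (x ∷ xs) k f = trans (distribˡ k _ _) (+-congˡ (*-distribˡ-∑ xs k f))

  ∑-++ : ∀ (xs ys : List X) f → ∑ (xs ++ ys) f ≈ ∑ xs f + ∑ ys f
  ∑-++ []       ys f = sym (+-identityˡ _)
  ∑-++ (x ∷ xs) ys f = trans (+-congˡ (∑-++ xs ys f)) (sym (+-assoc _ _ _))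

  ∑⊆-cong : ∀ (E : Subset n) {f g : ∀ A → A ⊆ E → Carrier} →
    (∀ A (A⊆E : A ⊆ E) → f A A⊆E ≈ g A A⊆E) → ∑⊆ E f ≈ ∑⊆ E g
  ∑⊆-cong E f≈g = ∑-cong (subsets E) (λ (A , A⊆E) → f≈g A A⊆E)

  ∑⊆-distrib-+ : ∀ (E : Subset n) (f g : ∀ A → A ⊆ E → Carrier) →
    ∑⊆ E (λ A A⊆E → f A A⊆E + g A A⊆E) ≈ ∑⊆ E f + ∑⊆ E g
  ∑⊆-distrib-+ E f g =
    ∑-distrib-+ (subsets E) (λ (A , A⊆E) → f A A⊆E) (λ (A , A⊆E) → g A A⊆E)

  *-distribˡ-∑⊆ : ∀ (E : Subset n) k (f : ∀ A → A ⊆ E → Carrier) →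
    k * ∑⊆ E f ≈ ∑⊆ E (λ A A⊆E → k * f A A⊆E)
  *-distribˡ-∑⊆ E k f = *-distribˡ-∑ (subsets E) k (λ (A , A⊆E) → f A A⊆E)

  -- Since `f` does not see inclusion proofs, those built by `skip` drop out, and the two sides
  -- differ only by the fusion of two maps.
  ∑⊆-outside : ∀ (E : Subset n) (f : Subset (ℕ.suc n) → Carrier) →
    ∑⊆ (outside ∷ E) (λ A _ → f A) ≡ ∑⊆ E (λ A _ → f (outside ∷ A))
  ∑⊆-outside E f = ≡.cong (foldr _+_ 0#) (≡.sym (map-∘ (subsets E)))

  ∑⊆-inside : ∀ (E : Subset n) (f : Subset (ℕ.suc n) → Carrier) →
    ∑⊆ (inside ∷ E) (λ A _ → f A) ≈
    ∑⊆ E (λ A _ → f (outside ∷ A)) + ∑⊆ E (λ A _ → f (inside ∷ A))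
  ∑⊆-inside E f = trans
    (∑-++ (List.map skip (subsets E)) (List.map take (subsets E)) (λ (A , _) → f A))
    (+-cong (reflexive (≡.cong (foldr _+_ 0#) (≡.sym (map-∘ (subsets E)))))
            (reflexive (≡.cong (foldr _+_ 0#) (≡.sym (map-∘ (subsets E))))))

  -- Induction on the ground set, deciding for its first element whether it lies in `F`, in `A` or
  -- in neither. The coefficient `g` is arbitrary, not a power of a rank, so that the induction
  -- hypothesis also applies to coefficients that have absorbed the weight of the first element.
  ∑⊆-expand : ∀ (E : Subset n) {v w u : Fin n → Carrier} (g : Subset n → Carrier) →
    (∀ e → v e ≈ w e + u e) →
    ∑⊆ E (λ S _ → g S * ∏ S v) ≈
    ∑⊆ E (λ F _ → ∑⊆ (E ─ F) (λ A _ → g (A ∪ F) * (∏ F w * ∏ A u)))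
  ∑⊆-expand [] g v≈w+u =
    trans (+-congʳ (*-congˡ (sym (*-identityˡ 1#)))) (sym (+-identityʳ _))
  ∑⊆-expand (outside ∷ E) {v} {w} {u} g v≈w+u = begin
    ∑⊆ (outside ∷ E) (λ S _ → g S * ∏ S v)
      ≡⟨ ∑⊆-outside E (λ S → g S * ∏ S v) ⟩
    ∑⊆ E (λ S _ → g (outside ∷ S) * ∏ S (v ∘ suc))
      ≈⟨ ∑⊆-expand E (g ∘ (outside ∷_)) (v≈w+u ∘ suc) ⟩
    ∑⊆ E (λ F _ → ∑⊆ (E ─ F) (λ A _ →
      g (outside ∷ (A ∪ F)) * (∏ F (w ∘ suc) * ∏ A (u ∘ suc))))
      ≈⟨ ∑⊆-cong E (λ F _ → reflexive (∑⊆-outside (E ─ F) (term (outside ∷ F)))) ⟨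
    ∑⊆ E (λ F _ → ∑⊆ (outside ∷ (E ─ F)) (λ A _ → term (outside ∷ F) A))
      ≡⟨ ∑⊆-outside E (λ F → ∑⊆ ((outside ∷ E) ─ F) (λ A _ → term F A)) ⟨
    ∑⊆ (outside ∷ E) (λ F _ → ∑⊆ ((outside ∷ E) ─ F) (λ A _ → term F A)) ∎
    where
    term : Subset _ → Subset _ → Carrier
    term F A = g (A ∪ F) * (∏ F w * ∏ A u)
  ∑⊆-expand (inside ∷ E) {v} {w} {u} g v≈w+u = begin
    ∑⊆ (inside ∷ E) (λ S _ → g S * ∏ S v)
      ≈⟨ ∑⊆-inside E (λ S → g S * ∏ S v) ⟩
    ∑⊆ E (λ S _ → g (outside ∷ S) * ∏ S (v ∘ suc)) +
    ∑⊆ E (λ S _ → g (inside ∷ S) * (v zero * ∏ S (v ∘ suc)))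
      -- Moves `v zero` from the product into the coefficient, the shape the second use of the
      -- induction hypothesis needs.
      ≈⟨ +-congˡ (∑⊆-cong E (λ S _ → sym (*-assoc _ _ _))) ⟩
    ∑⊆ E (λ S _ → g (outside ∷ S) * ∏ S (v ∘ suc)) +
    ∑⊆ E (λ S _ → g (inside ∷ S) * v zero * ∏ S (v ∘ suc))
      ≈⟨ +-cong (∑⊆-expand E (g ∘ (outside ∷_)) (v≈w+u ∘ suc))
                (∑⊆-expand E (λ S → g (inside ∷ S) * v zero) (v≈w+u ∘ suc)) ⟩
    ∑⊆ E neither +
    ∑⊆ E (λ F _ → ∑⊆ (E ─ F) (λ A _ →
      g (inside ∷ (A ∪ F)) * v zero * (∏ F (w ∘ suc) * ∏ A (u ∘ suc))))
      -- Writing `v zero` as `w zero + u zero` decides where the first element goes: the summand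
      -- `u zero` puts it in `A`, the summand `w zero` in `F`.
      ≈⟨ +-congˡ (∑⊆-cong E (λ F _ → trans
           (∑⊆-cong (E ─ F) (λ A _ → split (g (inside ∷ (A ∪ F))) _ _))
           (∑⊆-distrib-+ (E ─ F) _ _))) ⟩
    ∑⊆ E neither + ∑⊆ E (λ F F⊆E → in-A F F⊆E + in-F F F⊆E)
      ≈⟨ +-congˡ (∑⊆-distrib-+ E in-A in-F) ⟩
    ∑⊆ E neither + (∑⊆ E in-A + ∑⊆ E in-F)
      ≈⟨ +-assoc _ _ _ ⟨
    (∑⊆ E neither + ∑⊆ E in-A) + ∑⊆ E in-F
      ≈⟨ +-congʳ (∑⊆-distrib-+ E neither in-A) ⟨
    ∑⊆ E (λ F F⊆E → neither F F⊆E + in-A F F⊆E) + ∑⊆ E in-F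
      -- If `F` omits the first element, that element survives in the difference, and `neither` and
      -- `in-A` are the two choices for `A`. If `F` contains it, it is removed, and only `in-F`
      -- remains.
      ≈⟨ +-cong (∑⊆-cong E (λ F _ → ∑⊆-inside (E ─ F) (term (outside ∷ F))))
                (∑⊆-cong E (λ F _ → reflexive (∑⊆-outside (E ─ F) (term (inside ∷ F))))) ⟨
    ∑⊆ E (λ F _ → ∑⊆ (inside ∷ (E ─ F)) (λ A _ → term (outside ∷ F) A)) +
    ∑⊆ E (λ F _ → ∑⊆ (outside ∷ (E ─ F)) (λ A _ → term (inside ∷ F) A))
      ≈⟨ ∑⊆-inside E (λ F → ∑⊆ ((inside ∷ E) ─ F) (λ A _ → term F A)) ⟨
    ∑⊆ (inside ∷ E) (λ F _ → ∑⊆ ((inside ∷ E) ─ F) (λ A _ → term F A)) ∎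
    where
    term : Subset _ → Subset _ → Carrier
    term F A = g (A ∪ F) * (∏ F w * ∏ A u)

    -- The names say where the first element of `inside ∷ E` lies.
    neither in-A in-F : ∀ F → F ⊆ E → Carrier
    neither F _ = ∑⊆ (E ─ F) (λ A _ → term (outside ∷ F) (outside ∷ A))
    in-A    F _ = ∑⊆ (E ─ F) (λ A _ → term (outside ∷ F) (inside ∷ A))
    in-F    F _ = ∑⊆ (E ─ F) (λ A _ → term (inside ∷ F) (outside ∷ A))

    split : ∀ x y z →
      x * v zero * (y * z) ≈ x * (y * (u zero * z)) + x * (w zero * y * z)
    split x y z = begin
      x * v zero * (y * z)
        ≈⟨ *-assoc _ _ _ ⟩
      x * (v zero * (y * z))
        ≈⟨ *-congˡ (*-congʳ (trans (v≈w+u zero) (+-comm _ _))) ⟩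
      x * ((u zero + w zero) * (y * z))
        ≈⟨ *-congˡ (distribʳ _ _ _) ⟩
      x * (u zero * (y * z) + w zero * (y * z))
        ≈⟨ *-congˡ (+-cong (x∙yz≈y∙xz _ _ _) (sym (*-assoc _ _ _))) ⟩
      x * (y * (u zero * z) + w zero * y * z)
        ≈⟨ distribˡ _ _ _ ⟩
      x * (y * (u zero * z)) + x * (w zero * y * z) ∎

  -- Meant for `m` the rank of `F` and `k` that of `A ∪ F`: as `m ≤ k`, the truncated difference is
  -- exact, so the power splits into a share for `F` and a share for the rank of `A` in the
  -- contraction.
  ^-∸-absorb : ∀ x {m k} (y z : Carrier) → m ℕ.≤ k →
    x ^ k * (y * z) ≈ x ^ m * y * (x ^ (k ∸ m) * z)
  ^-∸-absorb x {m} {k} y z m≤k = begin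
    x ^ k * (y * z)                  ≈⟨ *-congʳ (^-congʳ x (m+[n∸m]≡n m≤k)) ⟨
    x ^ (m ℕ.+ (k ∸ m)) * (y * z)    ≈⟨ *-congʳ (^-homo-* x m (k ∸ m)) ⟩
    x ^ m * x ^ (k ∸ m) * (y * z)    ≈⟨ interchange _ _ _ _ ⟩
    x ^ m * y * (x ^ (k ∸ m) * z)    ∎

theorem3p4 : ∀ {c ℓ₁ ℓ₂} (K : HeytingField c ℓ₁ ℓ₂) (n : ℕ) (M : Matroid n) →
    let open HeytingField K
        open Potts K
        open Matroid M
    in
    (q : Carrier) (q#0 : q # 0#) (v u : Fin n → Carrier) →
    Z̃ M q q#0 v ≈
      ∑⊆ ground (λ F F⊆E →
        inv q q#0 ^ rank F * ∏ F (λ e → v e - u e) * Z̃ (contract M F F⊆E) q q#0 u)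
theorem3p4 K n M q q#0 v u = trans
  (∑⊆-expand K ground (λ S → p ^ rank S)
    -- Here `w e` is `v e - u e`, and adding `u e` back gives `v e`.
    (λ e → sym (GroupProperties.//-rightDividesˡ +-group (u e) (v e))))
  (∑⊆-cong K ground λ F F⊆E → trans
    (∑⊆-cong K (ground ─ F) λ A A⊆E─F →
      ^-∸-absorb K p (∏ F (λ e → v e - u e)) (∏ A u)
        -- Monotonicity is available only inside the ground set, hence the proof that `A ∪ F` stays
        -- within it.
        (rank-monotone (q⊆p∪q A F)
          (∪-lub A F (λ x∈A → p─q⊆p ground F (A⊆E─F x∈A)) F⊆E)))
    -- The factor depending on `F` alone leaves the inner sum, and what remains is `Z̃` of the
    -- contraction by definition.
    (sym (*-distribˡ-∑⊆ K (ground ─ F) _ (λ A _ → p ^ (rank (A ∪ F) ∸ rank F) * ∏ A u))))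
  where
  open HeytingField K using (heytingCommutativeRing)
  open HeytingCommutativeRing heytingCommutativeRing using (commutativeRing)
  open CommutativeRing commutativeRing using (Carrier; _-_; _*_; sym; trans; +-group)
  open Potts K
  open Matroid M

  p : Carrier
  p = inv q q#0
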